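{- Let $Q$ be a fixed IPC formula and let $\phi : K \to L$ be the map defined in the context. Then for every PC formula $Z \in K$, $Q \vdash_L \phi(Z)$.
   Context: $K$ is the set of PC formulas: built from propositional variables and a propositional constant $\mathfrak{f}$ using only the conditional $\supset$. $L \subseteq K$ is the set of IPC formulas: built from propositional variables using only $\supset$. IPC has Modus Ponens as its only rule and axioms all instances (with IPC formulas) of $(\#1)\ A \supset (B \supset A)$; $(\#2)\ [A \supset (B \supset C)] \supset [(A \supset B) \supset (A \supset C)]$; $(\mathbb{P})\ [(A \supset B) \supset A] \supset A$. $\Gamma \vdash_L Y$ means there is a deduction of $Y$ from hypotheses $\Gamma$ in IPC. For an IPC formula $Z$ write $QZ := Z \supset Q$ and $QQZ := (Z \supset Q)\supset Q$. The map $\phi : K \to L$ is defined by induction on the number of conditionals: $\phi(\mathfrak{f}) = Q$; $\phi(p) = QQp = (p \supset Q) \supset Q$ for each propositional variable $p$; and $\phi(X \supset Y) = \phi(X) \supset \phi(Y)$. -}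

module Defs where

open import Level using (0ℓ)
open import Relation.Unary using (Pred; _∈_)

infixr 5 _⊃_
infix 3 _⊢L_

-- PC formulas, over an arbitrary stock of propositional variables.
data K (Var : Set) : Set where
  var : Var → K Var
  𝔣   : K Var
  _⊃_ : K Var → K Var → K Var

-- IPC formulas: the PC formulas in which 𝔣 does not occur.
data L (Var : Set) : Set where
  var : Var → L Var
  _⊃_ : L Var → L Var → L Var

L⊆K : {Var : Set} → L Var → K Var
L⊆K (var p) = var p
L⊆K (A ⊃ B) = L⊆K A ⊃ L⊆K B

data Axiom {Var : Set} : Pred (L Var) 0ℓ where
  #1 : ∀ A B → Axiom (A ⊃ (B ⊃ A))
  #2 : ∀ A B C → Axiom ((A ⊃ (B ⊃ C)) ⊃ ((A ⊃ B) ⊃ (A ⊃ C)))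
  ℙ  : ∀ A B → Axiom (((A ⊃ B) ⊃ A) ⊃ A)

-- Deductions in IPC from a set Γ of hypotheses, presented as trees.
data _⊢L_ {Var : Set} (Γ : Pred (L Var) 0ℓ) : L Var → Set where
  hypothesis   : ∀ {A} → A ∈ Γ → Γ ⊢L A
  axiom        : ∀ {A} → A ∈ Axiom → Γ ⊢L A
  modus-ponens : ∀ {A B} → Γ ⊢L A ⊃ B → Γ ⊢L A → Γ ⊢L B

Q[_]_ : {Var : Set} → L Var → L Var → L Var
Q[ Q ] Z = Z ⊃ Q

QQ[_]_ : {Var : Set} → L Var → L Var → L Var
QQ[ Q ] Z = Q[ Q ] (Q[ Q ] Z)

φ : {Var : Set} → L Var → K Var → L Var
φ Q 𝔣       = Q
φ Q (var p) = QQ[ Q ] (var p)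
φ Q (X ⊃ Y) = φ Q X ⊃ φ Q Y

{-# OPTIONS --safe #-}
module Submission where

open import Level using (0ℓ)
open import Relation.Binary.PropositionalEquality using (refl)
open import Relation.Unary using (Pred; ｛_｝)
open import Defs

-- Each `φ Q Z` is a chain of conditionals whose final consequent is `Q`: descend through
-- consequents to `𝔣` or a variable. So `Q` yields it by prefixing antecedents with `#1`, by
-- induction on `Z`.

weaken : {Var : Set} {Γ : Pred (L Var) 0ℓ} {A : L Var} (B : L Var) → Γ ⊢L A → Γ ⊢L B ⊃ A
weaken B d = modus-ponens (axiom (#1 _ B)) d

theorem4 : {Var : Set} (Q : L Var) (Z : K Var) → ｛ Q ｝ ⊢L φ Q Z
-- `QQ[ Q ] (var p)` unfolds to `Q[ Q ] (var p) ⊃ Q`, whose consequent is the hypothesis.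
theorem4 Q (var p) = weaken (Q[ Q ] (var p)) (hypothesis refl)
theorem4 Q 𝔣       = hypothesis refl
-- Induction on the consequent suffices.
theorem4 Q (X ⊃ Y) = weaken (φ Q X) (theorem4 Q Y)
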